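{- Every circular 3G matching market of size $N=4$ (four women, four men and four dogs) has a stable matching.
   Context: A circular 3G matching market of size $N$ consists of three disjoint sets of agents (three "genders"), each of size $N$: women $a_1,\dots,a_N$, men $b_1,\dots,b_N$, and dogs $c_1,\dots,c_N$. Every woman has a strict linear preference order on the set of all $N$ men, every man has a strict linear preference order on the set of all $N$ dogs, and every dog has a strict linear preference order on the set of all $N$ women. These orders are arbitrary. A triple consists of one woman, one man and one dog. Agents compare triples containing themselves by the circular rule: a woman strictly prefers one triple to another if and only if she strictly prefers the man in the first to the man in the second; likewise, men compare triples only by the dog in them, and dogs only by the woman in them. A matching is a partition of all the agents into $N$ triples, each consisting of one woman, one man and one dog. A triple $T$ is a blocking triple for a matching if each of the three members of $T$ strictly prefers $T$ to the triple containing that member in the matching. A matching is stable if it has no blocking triple. -}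

module Defs where

open import Data.Fin.Base using (Fin)
open import Data.Nat.Base using (ℕ)
open import Data.Product using (∃!; proj₁)
open import Level using (0ℓ)
open import Relation.Binary.Core using (Rel)
open import Relation.Binary.PropositionalEquality.Core using (_≡_)
open import Relation.Binary.Structures using (IsStrictTotalOrder)
open import Relation.Nullary.Negation.Core using (¬_)

data Gender : Set where
  woman man dog : Gender

-- Agents of gender g have preferences over the agents of gender next g.
next : Gender → Gender
next woman = man
next man   = dog
next dog   = woman

-- A record rather than an abbreviation for Fin N, so that the three
-- genders are distinct types.
record Agent (N : ℕ) (g : Gender) : Set where
  constructor agent
  field
    index : Fin N

-- prefers x y z: agent x strictly prefers y to z.
record Market (N : ℕ) : Set₁ where
  field
    prefers : {g : Gender} → Agent N g → Rel (Agent N (next g)) 0ℓ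
    isStrictTotalOrder : {g : Gender} (x : Agent N g) →
                         IsStrictTotalOrder _≡_ (prefers x)

Triple : ℕ → Set
Triple N = (g : Gender) → Agent N g

-- The partition is presented as a family of N triples such that every
-- agent belongs to exactly one of them.
record Matching (N : ℕ) : Set where
  field
    triple    : Fin N → Triple N
    partition : {g : Gender} (x : Agent N g) → ∃! _≡_ λ i → triple i g ≡ x

  tripleOf : {g : Gender} → Agent N g → Triple N
  tripleOf x = triple (proj₁ (partition x))

module _ {N : ℕ} (M : Market N) where
  open Market M

  PrefersTriple : {g : Gender} → Agent N g → Rel (Triple N) 0ℓ
  PrefersTriple {g} x T T′ = prefers x (T (next g)) (T′ (next g))

  Blocks : Triple N → Matching N → Set
  Blocks T μ = (g : Gender) → PrefersTriple (T g) T (Matching.tripleOf μ (T g))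

  Stable : Matching N → Set
  Stable μ = (T : Triple N) → ¬ Blocks T μ

-- Number the women by the preferences of some dog, the men by those of woman 0 and the dogs
-- by those of man 0; the dog that was chosen becomes dog k.  For each of the four values of k
-- a decision tree, found by computer search, asks agents for their favourite among a few
-- candidates; at each leaf the answers already force one particular matching to be stable.
-- The trees have 965 leaves in total and are checked by evaluation.

module Submission where

open import Defs
open import Data.Bool.Base using (Bool; true; false; T; _∧_; _∨_; if_then_else_)
open import Data.Bool.Properties using (T-∧; T-∨)
import Data.Char.Base as Char
open import Data.Fin.Base using (Fin; zero; suc; punchIn; _≤_)
open import Data.Fin.Patterns using (0F; 1F; 2F; 3F)
open import Data.Fin.Permutation using (Permutation′; insert; insert-punchIn; _⟨$⟩ʳ_; _⟨$⟩ˡ_)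
import Data.Fin.Permutation as Perm
open import Data.Fin.Properties using (_≟_; _≤?_)
open import Data.List.Base as List using (List; []; _∷_)
open import Data.List.Membership.Propositional.Properties using (∈-allFin)
open import Data.List.Relation.Unary.All as All using (All; []; _∷_)
open import Data.List.Relation.Unary.All.Properties using (map⁺)
open import Data.List.Relation.Unary.Any as Any using (Any; here; there)
open import Data.Nat.Base using (ℕ; zero; suc; _!; _∸_; _/_; _%_; _≡ᵇ_; _<ᵇ_; s≤s)
open import Data.Nat.DivMod using (_mod_)
open import Data.Product.Base using (∃; ∃₂; _×_; _,_; proj₁; proj₂; map₁)
open import Data.String.Base as String using (String)
open import Data.Sum.Base using (_⊎_; inj₁; inj₂; [_,_]′)
import Data.Sum.Base as Sum
open import Data.Unit.Base using (tt)
open import Data.Vec.Base as Vec using (Vec; []; _∷_; lookup; tabulate; updateAt)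
open import Data.Vec.Properties using (lookup∘tabulate)
open import Function.Base using (_∘_; id)
open import Function.Bundles using (_↔_; Inverse; Equivalence; mk↔ₛ′)
open import Function.Construct.Composition using (_↔-∘_)
open import Level using (0ℓ)
open import Relation.Binary.Core using (Rel)
import Relation.Binary.Construct.On as On
import Relation.Binary.Construct.StrictToNonStrict as StrictToNonStrict
open import Relation.Binary.PropositionalEquality.Core using (_≡_; refl; sym; trans; cong; subst; subst₂)
open import Relation.Binary.Structures using (IsTotalOrder; IsStrictTotalOrder)
open import Relation.Nullary.Decidable using (toWitness; isYes)
open import Relation.Nullary.Negation.Core using (¬_)

-- Greatest elements and rankings in finite total orders.

module _ {A : Set} {_≈_ _≽_ : Rel A 0ℓ} (isTotalOrder : IsTotalOrder _≈_ _≽_) where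
  private module ≽ = IsTotalOrder isTotalOrder

  -- `x` is compared with the winner of the tail. The result is an `Any` because the position of the
  -- winner later selects a branch of a decision tree.
  any-greatest : ∀ {B : Set} (f : B → A) x xs →
                 Any (λ y → All (λ z → f y ≽ f z) (x ∷ xs)) (x ∷ xs)
  any-greatest f x []       = here (≽.refl ∷ [])
  any-greatest f x (y ∷ ys) = step (any-greatest f y ys)
    where
    step : ∀ {zs} → Any (λ u → All (λ v → f u ≽ f v) (y ∷ ys)) zs →
           Any (λ u → All (λ v → f u ≽ f v) (x ∷ y ∷ ys)) (x ∷ zs)
    step {z ∷ _} (here z≽) with ≽.total (f x) (f z)
    ... | inj₁ x≽z = here (≽.refl ∷ All.map (≽.trans x≽z) z≽)
    ... | inj₂ z≽x = there (here (z≽x ∷ z≽))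
    step (there p) with step p
    ... | here q  = here q
    ... | there q = there (there q)

greatest : ∀ {n} {_≈_ _≽_ : Rel (Fin (suc n)) 0ℓ} → IsTotalOrder _≈_ _≽_ → ∃ λ x → ∀ y → x ≽ y
greatest ord with x , x≽ ← Any.satisfied (any-greatest ord id zero (List.tabulate suc)) =
  x , λ y → All.lookup x≽ (∈-allFin y)

-- Selection sort: the greatest element comes first, and the others, reached through `punchIn top`,
-- are ranked recursively.
ranking : ∀ n {_≈_ _≽_ : Rel (Fin n) 0ℓ} → IsTotalOrder _≈_ _≽_ →
          ∃ λ (π : Permutation′ n) → ∀ {i j} → i ≤ j → (π ⟨$⟩ʳ i) ≽ (π ⟨$⟩ʳ j)
ranking zero    ord = Perm.id , λ { {()} }
ranking (suc n) {_≽_ = _≽_} ord with top , top≽ ← greatest ord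
  with π , π-mono ← ranking n (On.isTotalOrder (punchIn top) ord)
  = insert zero top π , mono
  where
  mono : ∀ {i j} → i ≤ j → (insert zero top π ⟨$⟩ʳ i) ≽ (insert zero top π ⟨$⟩ʳ j)
  mono {zero}          _         = top≽ _
  mono {suc i} {suc j} (s≤s i≤j)
    rewrite insert-punchIn zero top π i | insert-punchIn zero top π j = π-mono i≤j

-- `P` depends on the index because each agent has its own preference relation.
updateAt-preserves : ∀ {n} {A : Set} (P : Fin n → A → Set) (xs : Vec A n) i (f : A → A) →
                     (∀ {x} → P i x → P i (f x)) →
                     (∀ j → P j (lookup xs j)) → ∀ j → P j (lookup (updateAt xs i f) j)
updateAt-preserves P (x ∷ xs) zero    f pf p zero    = pf (p zero)
updateAt-preserves P (x ∷ xs) zero    f pf p (suc j) = p (suc j)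
updateAt-preserves P (x ∷ xs) (suc i) f pf p zero    = p zero
updateAt-preserves P (x ∷ xs) (suc i) f pf p (suc j) =
  updateAt-preserves (P ∘ suc) xs i f pf (p ∘ suc) j

forAll : ∀ {n} → (Fin n → Bool) → Bool
forAll {zero}  f = true
forAll {suc n} f = f zero ∧ forAll (f ∘ suc)

forAll-sound : ∀ {n} (f : Fin n → Bool) → T (forAll f) → ∀ i → T (f i)
forAll-sound f ok zero    = proj₁ (Equivalence.to (T-∧ {f zero}) ok)
forAll-sound f ok (suc i) = forAll-sound (f ∘ suc) (proj₂ (Equivalence.to (T-∧ {f zero}) ok)) i

-- Partial knowledge of one preference order.

-- Partial knowledge of a preference order: if entry (y , z) is true, then y is at least as
-- good as z; if it is false, nothing is known.
Bounds : Set
Bounds = Vec (Vec Bool 4) 4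

_⟦_,_⟧ : Bounds → Fin 4 → Fin 4 → Bool
m ⟦ y , z ⟧ = lookup (lookup m y) z

bounds : (Fin 4 → Fin 4 → Bool) → Bounds
bounds f = tabulate λ y → tabulate (f y)

record _⊑_ (m : Bounds) (_≽_ : Rel (Fin 4) 0ℓ) : Set where
  constructor entrywise
  field holds : ∀ {y z} → T (m ⟦ y , z ⟧) → y ≽ z

open _⊑_

bounds-⊑ : ∀ f {_≽_} → (∀ y z → T (f y z) → y ≽ z) → bounds f ⊑ _≽_
bounds-⊑ f f⇒≽ = entrywise λ {y} {z} t → f⇒≽ y z (subst T
  (trans (cong (λ row → lookup row z) (lookup∘tabulate (λ y → tabulate (f y)) y))
         (lookup∘tabulate (f y) z)) t)

-- If `m` is reflexive and transitive, one pass already yields the transitive closure, since a path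
-- needs the new pair at most once.
addBound : Fin 4 → Fin 4 → Bounds → Bounds
addBound y z m = bounds λ u v → m ⟦ u , v ⟧ ∨ m ⟦ u , y ⟧ ∧ m ⟦ z , v ⟧

module _ {_≈_ _≽_ : Rel (Fin 4) 0ℓ} (isTotalOrder : IsTotalOrder _≈_ _≽_) where
  private module ≽ = IsTotalOrder isTotalOrder

  addBound-⊑ : ∀ {m y z} → y ≽ z → m ⊑ _≽_ → addBound y z m ⊑ _≽_
  addBound-⊑ {m} {y} {z} y≽z m⊑ = bounds-⊑ _ λ u v →
    [ holds m⊑
    , (λ t → let uy , zv = Equivalence.to (T-∧ {m ⟦ u , y ⟧}) t
             in ≽.trans (holds m⊑ uy) (≽.trans y≽z (holds m⊑ zv)))
    ]′ ∘ Equivalence.to (T-∨ {m ⟦ u , v ⟧})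

  addBounds-⊑ : ∀ {m y zs} → All (y ≽_) zs → m ⊑ _≽_ →
                List.foldr (addBound y) m zs ⊑ _≽_
  addBounds-⊑ []           m⊑ = m⊑
  addBounds-⊑ (y≽z ∷ y≽zs) m⊑ = addBound-⊑ y≽z (addBounds-⊑ y≽zs m⊑)

-- Knowledge about all agents, and stability of a labelled matching.

-- Indexed by the genders in the order woman, man, dog, and then by the agents.
Knowledge : Set
Knowledge = Vec (Vec Bounds 4) 3

Profile : Set₁
Profile = Fin 3 → Fin 4 → Rel (Fin 4) 0ℓ

_⊨_ : Profile → Knowledge → Set
P ⊨ K = ∀ i x → lookup (lookup K i) x ⊑ P i x

-- σ gives the man and ρ the dog of each woman.
partner : (σ ρ : Permutation′ 4) → Fin 3 → Fin 4 → Fin 4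
partner σ ρ 0F a = σ ⟨$⟩ʳ a
partner σ ρ 1F b = ρ ⟨$⟩ʳ (σ ⟨$⟩ˡ b)
partner σ ρ 2F c = ρ ⟨$⟩ˡ c

-- Satisfied i x y stands for: agent x of gender i does not prefer y to its present partner.
Unblocked : (Fin 3 → Rel (Fin 4) 0ℓ) → Set
Unblocked Satisfied = ∀ a b c → Satisfied 0F a b ⊎ Satisfied 1F b c ⊎ Satisfied 2F c a

unblockedAt : Vec Bounds 3 → Fin 4 → Fin 4 → Fin 4 → Bool
unblockedAt ms a b c =
  lookup ms 0F ⟦ a , b ⟧ ∨ lookup ms 1F ⟦ b , c ⟧ ∨ lookup ms 2F ⟦ c , a ⟧

unblocked : Vec Bounds 3 → Bool
unblocked ms = forAll λ a → forAll λ b → forAll (unblockedAt ms a b)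

unblocked-sound : ∀ ms → T (unblocked ms) → Unblocked λ i x y → T (lookup ms i ⟦ x , y ⟧)
unblocked-sound ms ok a b c =
  Sum.map₂ (Equivalence.to (T-∨ {lookup ms 1F ⟦ b , c ⟧}))
    (Equivalence.to (T-∨ {lookup ms 0F ⟦ a , b ⟧})
      (forAll-sound (unblockedAt ms a b)
        (forAll-sound (λ b → forAll (unblockedAt ms a b))
          (forAll-sound (λ a → forAll λ b → forAll (unblockedAt ms a b)) ok a) b) c))

StableFor : Profile → Permutation′ 4 → Permutation′ 4 → Set
StableFor P σ ρ = Unblocked λ i x y → P i x (partner σ ρ i x) y

-- Tabulated, so that the partners are computed once per matching and not once per triple.
partnerRows : (Fin 3 → Fin 4 → Fin 4) → Knowledge → Vec Bounds 3
partnerRows p K = tabulate λ i → tabulate λ x → lookup (lookup (lookup K i) x) (p i x)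

partnerRows-⊨ : ∀ {P} p K → P ⊨ K → ∀ i x {y} →
                T (lookup (partnerRows p K) i ⟦ x , y ⟧) → P i x (p i x) y
partnerRows-⊨ p K P⊨K i x
  rewrite lookup∘tabulate (λ i → tabulate λ x → lookup (lookup (lookup K i) x) (p i x)) i
        | lookup∘tabulate (λ x → lookup (lookup (lookup K i) x) (p i x)) x = holds (P⊨K i x)

-- Decision trees and the soundness of their check.

-- In ask i x bs, the branch to follow is the one labelled with the candidate that agent x
-- of gender i likes best among the labels.
data Tree : Set where
  match : (σ ρ : Permutation′ 4) → Tree
  ask   : Fin 3 → Fin 4 → List (Fin 4 × Tree) → Tree

learn : Fin 3 → Fin 4 → Fin 4 → List (Fin 4) → Knowledge → Knowledge
learn i x y zs K = updateAt K i λ ms → updateAt ms x λ m → List.foldr (addBound y) m zs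

-- A leaf passes if the known bounds alone exclude every blocking triple. In `checkBranches`, `cs`
-- remains the full list of labels while the branches are consumed.
check         : Knowledge → Tree → Bool
checkBranches : Knowledge → Fin 3 → Fin 4 → List (Fin 4) → List (Fin 4 × Tree) → Bool
check K (match σ ρ)          = unblocked (partnerRows (partner σ ρ) K)
-- Without candidates there is no favourite, hence no branch to follow.
check K (ask i x [])         = false
check K (ask i x bs@(_ ∷ _)) = checkBranches K i x (List.map proj₁ bs) bs
checkBranches K i x cs []             = true
checkBranches K i x cs ((y , t) ∷ bs) = check (learn i x y cs K) t ∧ checkBranches K i x cs bs

module _ {E P : Profile} (isTotalOrder : ∀ i x → IsTotalOrder (E i x) (P i x)) where

  learn-⊨ : ∀ K i x {y zs} → All (P i x y) zs → P ⊨ K → P ⊨ learn i x y zs K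
  learn-⊨ K i x y≽ = updateAt-preserves (λ i ms → ∀ x → lookup ms x ⊑ P i x) K i _ λ {ms} →
    updateAt-preserves (λ x m → m ⊑ P i x) ms x _ (addBounds-⊑ (isTotalOrder i x) y≽)

  -- The true preferences single out a path from the root to a leaf; every bound learned along it is
  -- true, so what the leaf deduces from the bounds holds for `P`.
  check-sound : ∀ K t → P ⊨ K → T (check K t) → ∃₂ (StableFor P)
  checkBranches-sound : ∀ K i x cs bs → P ⊨ K → T (checkBranches K i x cs bs) →
    Any (λ b → All (P i x (proj₁ b)) cs) bs → ∃₂ (StableFor P)
  check-sound K (match σ ρ) P⊨K ok = σ , ρ , λ a b c →
    Sum.map (row 0F a) (Sum.map (row 1F b) (row 2F c))
      (unblocked-sound (partnerRows (partner σ ρ) K) ok a b c)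
    where row = partnerRows-⊨ (partner σ ρ) K P⊨K
  check-sound K (ask i x (b ∷ bs)) P⊨K ok =
    checkBranches-sound K i x _ (b ∷ bs) P⊨K ok
      (Any.map map⁺ (any-greatest (isTotalOrder i x) proj₁ b bs))
  checkBranches-sound K i x cs ((y , t) ∷ bs) P⊨K ok best
    with ok-t , ok-bs ← Equivalence.to (T-∧ {check (learn i x y cs K) t}) ok | best
  ... | here y≽    = check-sound _ t (learn-⊨ K i x y≽ P⊨K) ok-t
  ... | there best = checkBranches-sound K i x cs bs P⊨K ok-bs best

-- Knowledge that follows from the choice of labels.

-- The dogs are numbered by man 0, so the number `k` of the dog that ranked the women cannot be
-- prescribed as well.
pivot : Fin 4 → Fin 3 → Fin 4
pivot k 0F = 0F
pivot k 1F = 0F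
pivot k 2F = k

-- Agent pivot k i of gender i has the preference order 0, 1, 2, 3.
initially : Fin 4 → Fin 3 → Fin 4 → Fin 4 → Fin 4 → Bool
initially k i x y z = isYes (y ≟ z) ∨ isYes (x ≟ pivot k i) ∧ isYes (y ≤? z)

initial : Fin 4 → Knowledge
initial k = tabulate λ i → tabulate λ x → bounds (initially k i x)

initial-⊨ : ∀ {E P : Profile} k → (∀ i x → IsTotalOrder (E i x) (P i x)) →
            (∀ i {y z} → y ≤ z → P i (pivot k i) y z) → P ⊨ initial k
initial-⊨ {P = P} k isTotalOrder ranked i x
  rewrite lookup∘tabulate (λ i → tabulate λ x → bounds (initially k i x)) i
        | lookup∘tabulate (λ x → bounds (initially k i x)) x
  = bounds-⊑ _ λ y z →
      [ reflexive y z ∘ toWitness , ordered y z ∘ Equivalence.to (T-∧ {isYes (x ≟ pivot k i)}) ]′ ∘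
      Equivalence.to (T-∨ {isYes (y ≟ z)})
  where
  reflexive : ∀ y z → y ≡ z → P i x y z
  reflexive y .y refl = IsTotalOrder.refl (isTotalOrder i x)
  ordered : ∀ y z → T (isYes (x ≟ pivot k i)) × T (isYes (y ≤? z)) → P i x y z
  ordered y z (x≡p , y≤z) =
    subst (λ x → P i x y z) (sym (toWitness x≡p)) (ranked i (toWitness y≤z))

-- From labelled profiles to markets.

matching : ∀ {N} → (∀ g → Fin N ↔ Agent N g) → Matching N
matching e = record
  { triple    = λ i g → Inverse.to (e g) i
  ; partition = λ {g} x → Inverse.from (e g) x , Inverse.strictlyInverseˡ (e g) x ,
                          λ eq → Inverse.inverseʳ (e g) (sym eq)
  }

gender : Fin 3 → Gender
gender 0F = woman
gender 1F = man
gender 2F = dog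

module _ {N} (M : Market N) where
  open Market M

  -- `prefers` puts the better agent first, so this `≤` means "at least as good as".
  weaklyPrefers : ∀ {g} → Agent N g → Rel (Agent N (next g)) 0ℓ
  weaklyPrefers x = StrictToNonStrict._≤_ _≡_ (prefers x)

  weaklyPrefers-isTotalOrder : ∀ {g} (x : Agent N g) → IsTotalOrder _≡_ (weaklyPrefers x)
  weaklyPrefers-isTotalOrder x = StrictToNonStrict.isTotalOrder _ _ (isStrictTotalOrder x)

  weaklyPrefers⇒¬prefers : ∀ {g} {x : Agent N g} {y z} → weaklyPrefers x y z → ¬ prefers x z y
  weaklyPrefers⇒¬prefers {x = x} (inj₁ y>z)  z>y =
    IsStrictTotalOrder.asym (isStrictTotalOrder x) y>z z>y
  weaklyPrefers⇒¬prefers {x = x} (inj₂ refl) z>y =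
    IsStrictTotalOrder.irrefl (isStrictTotalOrder x) refl z>y

  -- Abstract because conversion checking would otherwise unfold the construction.
  abstract
    rankingBy : ∀ {g} (x : Agent N g) → ∃ λ (ℓ : Fin N ↔ Agent N (next g)) →
                ∀ {i j} → i ≤ j → weaklyPrefers x (Inverse.to ℓ i) (Inverse.to ℓ j)
    rankingBy x with π , mono ← ranking N (On.isTotalOrder agent (weaklyPrefers-isTotalOrder x)) =
      mk↔ₛ′ agent Agent.index (λ _ → refl) (λ _ → refl) ↔-∘ π , mono

module _ (M : Market 4) (ℓ : ∀ g → Fin 4 ↔ Agent 4 g) where
  private
    label : ∀ {g} → Fin 4 → Agent 4 g
    label = Inverse.to (ℓ _)

    unlabel : ∀ {g} → Agent 4 g → Fin 4
    unlabel = Inverse.from (ℓ _)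

  profile : Profile
  profile i x y z = weaklyPrefers M {gender i} (label x) (label y) (label z)

  profile-isTotalOrder : ∀ i x → IsTotalOrder (λ y z → label y ≡ label z) (profile i x)
  profile-isTotalOrder i x = On.isTotalOrder label (weaklyPrefers-isTotalOrder M (label x))

  module _ (σ ρ : Permutation′ 4) where
    -- Each triple is indexed by the label of its woman.
    labelledMatching : Matching 4
    labelledMatching = matching λ where
      woman → ℓ woman
      man   → ℓ man ↔-∘ σ
      dog   → ℓ dog ↔-∘ ρ

    unblocked⇒stable : StableFor profile σ ρ → Stable M labelledMatching
    unblocked⇒stable unblocked T blocks =
      [ content woman , [ content man , content dog ]′ ]′
        (unblocked (unlabel (T woman)) (unlabel (T man)) (unlabel (T dog)))
      where
      -- For each concrete `g` this computes to the label of the agent given by `partner σ ρ`.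
      present : ∀ g → Agent 4 (next g)
      present g = Matching.tripleOf labelledMatching (T g) (next g)

      content : ∀ g → ¬ weaklyPrefers M (label (unlabel (T g)))
                          (present g) (label (unlabel (T (next g))))
      content g p = weaklyPrefers⇒¬prefers M
        (subst₂ (λ x z → weaklyPrefers M x (present g) z)
          (Inverse.strictlyInverseˡ (ℓ _) _) (Inverse.strictlyInverseˡ (ℓ _) _) p) (blocks g)

  stableMatching : ∃₂ (StableFor profile) → ∃ (Stable M)
  stableMatching (σ , ρ , stable) = labelledMatching σ ρ , unblocked⇒stable σ ρ stable

-- Decoding and checking the decision trees.

-- The order is lexicographic in the sequence of images, starting with the identity.
perms : ∀ n → Vec (Permutation′ n) (n !)
perms zero    = Perm.id ∷ []
perms (suc n) = Vec.concat (Vec.map (λ i → Vec.map (insert zero i) (perms n)) (Vec.allFin (suc n)))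

bitSet : ∀ n → ℕ → List (Fin n)
bitSet zero    m = []
bitSet (suc n) m = if m % 2 ≡ᵇ 1 then zero ∷ rest else rest
  where rest = List.map suc (bitSet n (m / 2))

-- Trees are written in prefix notation, two characters per node: for match, letters a–x
-- give the positions of σ and ρ in perms 4; for ask, a letter A–L gives the position of
-- the agent in the list of women, men, dogs, and the code of the second character is 48
-- plus the bit set of the candidates.  The first argument bounds the depth.
parse         : ℕ → List ℕ → Tree × List ℕ
parseBranches : ℕ → List (Fin 4) → List ℕ → List (Fin 4 × Tree) × List ℕ
parseBranch   : ℕ → Fin 4 → List (Fin 4) → Tree × List ℕ → List (Fin 4 × Tree) × List ℕ
parse (suc n) (c ∷ d ∷ cs) =
  -- 65 and 97 are the codes of `A` and `a`; `mod 3` and `mod 24` serve to land in `Fin`.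
  if c <ᵇ 97
  then map₁ (ask ((c ∸ 65) / 4 mod 3) ((c ∸ 65) mod 4)) (parseBranches n (bitSet 4 (d ∸ 48)) cs)
  else (match (lookup (perms 4) ((c ∸ 97) mod 24)) (lookup (perms 4) ((d ∸ 97) mod 24)) , cs)
-- Malformed input or an exhausted depth bound gives a tree that `check` rejects.
parse _       cs           = ask 0F 0F [] , cs
parseBranches n []       cs = [] , cs
parseBranches n (y ∷ ys) cs = parseBranch n y ys (parse n cs)
parseBranch n y ys (t , cs) = map₁ ((y , t) ∷_) (parseBranches n ys cs)

certificate : Fin 4 → List String
certificate 0F =
  "F>J>B>aaG>caK6ccaaL6ceabH>eaK6ecbaL6eebbC>ccG>acK6ccaaL6ceabH>bcK6ecbaL6eebbD>ddG>bd" ∷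
  "K:ddbbL:dfbaH>adK:fdabL:ffaaK>B>acG>J6caacccL6cfadH>J6eabcecL6efbdC>caG>J6caacaaL6cf" ∷
  "adH>J6eabcbaL6efbdD>dbG>J:dbbdbbL:debcH>J:fbadabL:feacL>B>aeG>J6cbaeK6cdafceH>J6ebbe" ∷
  "K6edbfeeC>cbG>J6cbaeK6cdafabH>J6ebbeK6edbfbbD>daG>J:dabfK:dcbebaH>J:faafK:fcaeaa" ∷
  []
certificate 1F =
  "I>H<K<B6L<C6F<B<cgC:egbgchahbgL<C6chG<B:agC<fgdgahdgB6L<ahD6F<B<dhD:fhahdgbgL<chD6dg" ∷
  "G<B:bhD<ehchbgL<B6K<C6F<cgB<chC:ehbhagbhK<C6cgG<agB:ahC<fhdhdhB6K<agD6F<dhB<dgD:fgag" ∷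
  "bhK<cgD6dhG<bhB:bgD<egcgH<K:C6L:B6F<C<aiB:bieiakckeiL:B6akG<C:ciB<difickfiC6L:ckD6F<" ∷
  "C<fkD:dkckfieiL:akD6fiG<C:ekD<bkakeiL:C6K:B6F<aiC<akB:bkekciekK:B6aiG<ciC:ckB<dkfkfk" ∷
  "C6K:ciD6F<fkC<fiD:diciekK:aiD6fkG<ekC:eiD<biaiF<K6D<L6B<G<D:B6bjdjcjclelbjL6B<clH<D6" ∷
  "B:ajfjejelajD<L6elC<G<D:C6elflalajbjL6clC<ajH<D6C:cldlblbjL6D<K6B<G<cjD:B6bldlclejbl" ∷
  "K6B<cjH<ejD6B:alflelalD<K6ejC<G<alD:C6ejfjajblK6cjC<alH<blD6C:cjdjbj" ∷
  []
certificate 2F =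
  "J>I=B>L<F6abadaaL<G6cbcdcaL<H6ebedeaB?F<goC6C<L9guJ3I6mgL:B6akcicimoJ3ninogoC6L<C:I6" ∷
  "J<F:aoB<B5mnC3L:oqcocnrnanL:F:aoC=oqaqbqcoboaoaoL<G:coC6coC5ioL6C3iqcqI:C<B3gnandpap" ∷
  "coL<H:eoC:eoC9koL6C3kqeqI:C<fpB3hnbnbpeoB?D6L<gpD<G9hvL5hvJ3F3nphgnpJ3F:gjmpmphpL<ap" ∷
  "F:apF3L9avI:D<J5bgumomD6L6D=prbrardpbpL9avD<G;blbfbaooL<cpG:cpL9cvD6dpD5jpL:D3jrdrI6" ∷
  "D<B3hmbmcoboL<epH:epL9evD:fpD9lpL:D3lrfrI6D<eoB3gmamaoI;C>L:F6ceB<cfefccL:G6aeB:afff" ∷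
  "acL:H6beB6bfdfbcC?F<imB6B:L9B<isksJ5F5ogI<oiL<pjagomkmimB6L:B:I6L<F:cmB=mncnenamJ:F:" ∷
  "cmC<C5oqB3L<mnamaqpqcqemcmcmL:G:amB6amB5gmL6I<B<C3iqcqfrcrB3gnanamL:H:bmB:bmB9hmL6I<" ∷
  "B<drC3kqeqerB3hnbnbmC?D6L3D<kxixL:irJ5I<iiL6frdjqrkrD6L:crD:L9cxI<F:crC<J3fitonoF9dr" ∷
  "F:crC<I3fctmnmcrerL:arG:arL9axD6frD5lrL<D3lpfpI6emD<C3koeoamL:brH:brL9bxD:drD9jrL<D3" ∷
  "jpdpI6cmD<bmC3iocoD?I7F9jdB6L6D<bfB:aflfjdjdF<jnB6B:L5B<jtltJ9I:L<anagpjpnlnjnC6L6jq" ∷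
  "L3C<lwjwJ9I<L:eqcijjrqlqI6L6F:dnB:L<B6I;adanD=prbnandnB=I3B<dcfcnmdmfmfndnC6L6dqI5dd" ∷
  "C:L5dwI<F9cqF:dqD<I3edsnmnF:dqD<J3ejspmpdqfqI6L6G:bnB6bnB5hnL:I<dqB<D3jrdreqB3hmbmbn" ∷
  "L6bqG:bqI5bdL5bwC6eqC5kqL<I:fnC<D3lpfpbnC3koeoI6L6H:anB:anB9gnL:I<fqB<cqD3lrfrB3gmam" ∷
  "anL6aqH:aqI5adL5awC:cqC9iqL<I:dnC<anD3jpdpC3ioco" ∷
  []
certificate 3F =
  "I?K>B>J<F<acaeadJ<G<cccecdJ<H<eceeedJ>B<G:dadfH:faffC<G6feffH6dedfafJ6J:B6bbdbD<G6ef" ∷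
  "eeH6cfceD6debeB?K<J<C6F6msmtgsgtJ<gsD6F6ntnshtJ<K<J5F9agI<F<K6aiC6J3cgC5F6ouB<cgC9qk" ∷
  "blalagakalF5C5osasK6C<C5I9F<acaeoxaxpxJ:C?K9F9omI9F<G5ocF:oooqoeorosB5F6B9msesmtcvas" ∷
  "btF:C:C3C6J9igitgtethtgtasK<atJ9ahK9anF3D<J5bhusosJ:D<I5bbuuouF5D5ptbtK6D<D5I5bdpwbw" ∷
  "owD7jtdtbtJ=K<G9cgC3I<J<G<C:I9G:F6cccacfiljlckctclclchG5C3iscsK<K6C3C:I9G<ccceixjxcx" ∷
  "C7iscsJ:C<B3B:G6gsgtlvavdvatcsK<ctG5D3jtdtK9cnK:D:I5ddwwiwD7jtdtJ6D<B3B:G6hthskubucu" ∷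
  "bsK=J<H9emC3C6I9H<F5kclreekrlrerenJ<J5H9egC3C6I9H:H<F6eceaeeefklllelC;ksesC<ftB7H6hs" ∷
  "htH6bsbtH6dsdtetJ=ehesH5D3ltftK:D3I5rdlwfwD;ltftJ6D<euB6B3H6gtgsauiuasC?J:K:B6F6ouow" ∷
  "iuiuK:iwD6F6qwqukwJ?K:B6F<C<aiB:biekakcickK:K<F5B5mucuB=F<I9mamvgucvevB7guaucucuK;J:" ∷
  "I:F;cocmB=mncnepcrcqF3B<B5J9F9ciI9cdmjmwcwrwB<I9F:cccdxxrxF3D<J3eksumuD<I3eessmsK:cw" ∷
  "K9cqF5D5rwewK6D7lwfwewD<D5I3efrtetmtJ:B3K:G5guB6guB<K<B:I9G<aaabgvlvB5guC;iucudulwau" ∷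
  "K:G5auK6G3awJ<B:axfxB6aucwavauK:awJ9akG5D3lwfwK9aqK<D:I3ffttgtD7lwfwJ6euD<C:C3G6kqkk" ∷
  "eshsasJ;K:J:H9biB6B3I9H<F6baH:bcbdbbhjbjjjbwbkK:B;hubuB<dwJ<C7H6kukwH6euewH6fufwC7kw" ∷
  "ewfwbuK:bwK9bqH5D3jwdwK<D3I3pfjtdtD;jwdwJ6cuD<bsC6I3cemsgsD?J6K6B6F6pvpxjvjvK6jxC6F6" ∷
  "rxrvlxJ6K6J3F5dlB6F9djD<J9bjF6D5jlB3hjbvbjB:J9ajowfldjF5B5nvdvK:J<B:B6J5ajoxixlxB>J9" ∷
  "ajD<I5bdK3D5F6pvjrbpuwowK5dpwvK5fpqvB<B5I5F<dbG9naqunuduqudvK6dxJ5dlK5drF3C<J3fltvnv" ∷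
  "J<F5C5qxfxC<K;lrvxI3fetsK:pxnsC<I3ffttntJ6K6B7hvbvB3B<J<D;jxdxcxD:G5hvD3G6jpjjdwG5hv" ∷
  "iwexG3bxJ:K<dvG5bvB:bueubwbvK6bxJ5blG5C3kxexK5brK<C7kxexJ:fvC<D:D3G6lrllftgtbtC:I3ee" ∷
  "sshsJ6K6B;gvavB<cxD7H6lpljH6fvfxH6evexavK6axJ5alK5arH5C3ixcxK<C;ixcxJ:dvC<atD6I3dfnt" ∷
  "htC3I3oeiscs" ∷
  []

tree : Fin 4 → Tree
tree k = proj₁ (parse 100 (List.map Char.toℕ (List.concatMap String.toList (certificate k))))

-- For each concrete `k` the type evaluates to the unit type. Only the decoded tree matters, so
-- nothing has to be proved about `parse`.
tree-check : ∀ k → T (check (initial k) (tree k))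
tree-check 0F = tt
tree-check 1F = tt
tree-check 2F = tt
tree-check 3F = tt

-- Choice of labels and conclusion.

solvable : ∀ {E P : Profile} k → (∀ i x → IsTotalOrder (E i x) (P i x)) →
           (∀ i {y z} → y ≤ z → P i (pivot k i) y z) → ∃₂ (StableFor P)
solvable k isTotalOrder ranked =
  check-sound isTotalOrder (initial k) (tree k) (initial-⊨ k isTotalOrder ranked) (tree-check k)

theorem8 : (M : Market 4) → ∃ λ (μ : Matching 4) → Stable M μ
theorem8 M = stableMatching M ℓ (solvable k (profile-isTotalOrder M ℓ) ranked)
  where
  -- The first dog is arbitrary; label 0 then goes to its favourite woman, to her favourite man and
  -- to his favourite dog.
  byDog   = rankingBy M {dog}   (agent 0F)
  byWoman = rankingBy M {woman} (Inverse.to (proj₁ byDog) 0F)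
  byMan   = rankingBy M {man}   (Inverse.to (proj₁ byWoman) 0F)

  ℓ : ∀ g → Fin 4 ↔ Agent 4 g
  ℓ woman = proj₁ byDog
  ℓ man   = proj₁ byWoman
  ℓ dog   = proj₁ byMan

  k : Fin 4
  k = Inverse.from (ℓ dog) (agent 0F)

  ranked : ∀ i {y z} → y ≤ z → profile M ℓ i (pivot k i) y z
  ranked 0F = proj₂ byWoman
  ranked 1F = proj₂ byMan
  -- Labelling `k` gives back the chosen dog only up to a propositional equality.
  ranked 2F {y} {z} y≤z =
    subst (λ d → weaklyPrefers M d (Inverse.to (ℓ woman) y) (Inverse.to (ℓ woman) z))
      (sym (Inverse.strictlyInverseˡ (ℓ dog) (agent 0F))) (proj₂ byDog y≤z)
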